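{- There are non-trivial tight proper colorings $F:{}^{\omega}\omega\to\omega$.
   Context: ${}^{\omega}\omega$ is the set of functions from $\omega$ to $\omega$. Write $x\perp y$ ($x,y$ totally different) if $x(i)\ne y(i)$ for all $i\in\omega$. $F:{}^{\omega}\omega\to\omega$ is a proper coloring if $F(x)\ne F(y)$ whenever $x\perp y$. A proper coloring $F$ is tight if for all $x\in{}^{\omega}\omega$ and $\beta\in\omega$ with $F(x)\ne\beta$ there is $y\in{}^{\omega}\omega$ with $y\perp x$ and $F(y)=\beta$. A proper coloring $F$ is trivial if there are $i\in\omega$ and a bijection $\pi:\omega\to\omega$ with $F(x)=\pi(x(i))$ for all $x\in{}^{\omega}\omega$; otherwise it is non-trivial. -}

module Defs where

open import Data.Nat using (ℕ)
open import Data.Product using (_×_; Σ-syntax; ∃-syntax)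
open import Function.Bundles using (_⟶ₛ_; _⤖_; module Func; module Bijection)
open import Level using (0ℓ)
open import Relation.Binary.Bundles using (Setoid)
open import Relation.Binary.PropositionalEquality using (_≡_; _≢_; _→-setoid_; setoid)
open import Relation.Nullary using (¬_)

open Func using () renaming (to to color)

-- Sequences are compared pointwise: without function extensionality this, not
-- propositional equality, is the set-theoretic equality on ω^ω.
ω^ω : Setoid 0ℓ 0ℓ
ω^ω = ℕ →-setoid ℕ

infix 4 _⊥_

_⊥_ : (x y : ℕ → ℕ) → Set
x ⊥ y = ∀ i → x i ≢ y i

-- As a set-theoretic function on ω^ω must, F respects pointwise equality.
Coloring : Set
Coloring = ω^ω ⟶ₛ setoid ℕ

Proper : Coloring → Set
Proper F = ∀ x y → x ⊥ y → color F x ≢ color F y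

Tight : Coloring → Set
Tight F = ∀ x β → color F x ≢ β → ∃[ y ] (y ⊥ x × color F y ≡ β)

Trivial : Coloring → Set
Trivial F = Σ[ i ∈ ℕ ] Σ[ π ∈ ℕ ⤖ ℕ ] (∀ x → color F x ≡ Bijection.to π (x i))

NonTrivial : Coloring → Set
NonTrivial F = ¬ Trivial F

{-# OPTIONS --safe #-}
-- Cut ω³ into the blocks {2i,2i+1} × {2j,2j+1} × {2k,2k+1} and split each block into
-- its four triples of even coordinate sum and its four triples of odd coordinate sum.
-- Two triples in the same class differ in an even number of coordinates, so they share
-- one.  A triple outside a class avoids one of its members: from the same block flip all
-- three coordinates, which changes the parity, and from another block one coordinate is
-- free to adjust the parity.  F names the class of (x 0 , x 1 , x 2).
module Submission where

open import Data.Empty using (⊥-elim)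
open import Data.Nat using (ℕ; zero; suc; _+_; ⌊_/2⌋; _≟_)
open import Data.Nat.Properties
  using (+-comm; +-suc; +-identityʳ; suc-injective; 1+n≢n; n≡⌊n+n/2⌋)
open import Data.Product using (_×_; Σ-syntax; ∃-syntax; _,_; proj₁; proj₂)
open import Function.Base using (_∘_)
open import Function.Bundles using (module Bijection)
open import Relation.Binary.PropositionalEquality
open import Relation.Nullary using (yes; no)
open import Defs

open ≡-Reasoning

triangle : ℕ → ℕ
triangle zero    = zero
triangle (suc n) = suc (n + triangle n)

-- Cantor's pairing. A bijection is wanted, since tightness quantifies over every natural number as
-- a color.
pair : ℕ × ℕ → ℕ
pair (i , j) = j + triangle (i + j)

next : ℕ × ℕ → ℕ × ℕ
next (zero  , j) = suc j , zero
next (suc i , j) = i , suc j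

unpair : ℕ → ℕ × ℕ
unpair zero    = zero , zero
unpair (suc n) = next (unpair n)

pair-next : ∀ p → pair (next p) ≡ suc (pair p)
pair-next (zero  , j) = cong (λ k → suc (k + triangle k)) (+-identityʳ j)
pair-next (suc i , j) = cong (λ k → suc (j + triangle k)) (+-suc i j)

pair-unpair : ∀ n → pair (unpair n) ≡ n
pair-unpair zero    = refl
pair-unpair (suc n) = trans (pair-next (unpair n)) (cong suc (pair-unpair n))

-- Walks along the diagonal `s` by recursion on `j`; each new diagonal starts one step after the end
-- `(0 , s)` of the previous one.
unpair-diagonal : ∀ s j i → i + j ≡ s → unpair (j + triangle s) ≡ (i , j)
unpair-diagonal zero    zero    zero    _  = refl
unpair-diagonal (suc s) zero    (suc i) eq
  rewrite unpair-diagonal s s zero refl =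
  cong (_, zero) (trans (sym eq) (+-identityʳ (suc i)))
unpair-diagonal s       (suc j) i       eq
  rewrite unpair-diagonal s j (suc i) (trans (sym (+-suc i j)) eq) = refl

unpair-pair : ∀ p → unpair (pair p) ≡ p
unpair-pair (i , j) = unpair-diagonal (i + j) j i refl

pair-injective : ∀ {p q} → pair p ≡ pair q → p ≡ q
pair-injective {p} {q} eq =
  trans (sym (unpair-pair p)) (trans (cong unpair eq) (unpair-pair q))

flip : ℕ → ℕ
flip zero          = 1
flip (suc zero)    = zero
flip (suc (suc n)) = suc (suc (flip n))

flip-involutive : ∀ n → flip (flip n) ≡ n
flip-involutive zero          = refl
flip-involutive (suc zero)    = refl
flip-involutive (suc (suc n)) = cong (suc ∘ suc) (flip-involutive n)

flip-≢ : ∀ n → flip n ≢ n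
flip-≢ (suc (suc n)) = flip-≢ n ∘ suc-injective ∘ suc-injective

⌊flip/2⌋ : ∀ n → ⌊ flip n /2⌋ ≡ ⌊ n /2⌋
⌊flip/2⌋ zero          = refl
⌊flip/2⌋ (suc zero)    = refl
⌊flip/2⌋ (suc (suc n)) = cong suc (⌊flip/2⌋ n)

⌊/2⌋-≡⇒flip : ∀ m n → ⌊ m /2⌋ ≡ ⌊ n /2⌋ → m ≢ n → m ≡ flip n
⌊/2⌋-≡⇒flip zero          zero          _  m≢n = ⊥-elim (m≢n refl)
⌊/2⌋-≡⇒flip zero          (suc zero)    _  _   = refl
⌊/2⌋-≡⇒flip (suc zero)    zero          _  _   = refl
⌊/2⌋-≡⇒flip (suc zero)    (suc zero)    _  m≢n = ⊥-elim (m≢n refl)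
⌊/2⌋-≡⇒flip (suc (suc m)) (suc (suc n)) eq m≢n =
  cong (suc ∘ suc) (⌊/2⌋-≡⇒flip m n (suc-injective eq) (m≢n ∘ cong (suc ∘ suc)))

-- Depends on `k` only through its parity: the identity for even `k`, `flip` for odd `k`.
flips : ℕ → ℕ → ℕ
flips zero    c = c
flips (suc k) c = flip (flips k c)

flips-flip : ∀ k c → flips k (flip c) ≡ flip (flips k c)
flips-flip zero    c = refl
flips-flip (suc k) c = cong flip (flips-flip k c)

flips-involutive : ∀ k c → flips k (flips k c) ≡ c
flips-involutive zero    c = refl
flips-involutive (suc k) c = begin
  flip (flips k (flip (flips k c))) ≡⟨ cong flip (flips-flip k (flips k c)) ⟩
  flip (flip (flips k (flips k c))) ≡⟨ flip-involutive _ ⟩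
  flips k (flips k c)               ≡⟨ flips-involutive k c ⟩
  c                                 ∎

flips-injective : ∀ k {c d} → flips k c ≡ flips k d → c ≡ d
flips-injective k {c} {d} eq =
  trans (sym (flips-involutive k c)) (trans (cong (flips k) eq) (flips-involutive k d))

flips-flipˡ : ∀ a b c → flips (flip a + b) c ≡ flip (flips (a + b) c)
flips-flipˡ zero          b c = refl
flips-flipˡ (suc zero)    b c = sym (flip-involutive _)
flips-flipˡ (suc (suc a)) b c = cong (flip ∘ flip) (flips-flipˡ a b c)

flips-flipʳ : ∀ a b c → flips (a + flip b) c ≡ flip (flips (a + b) c)
flips-flipʳ a b c rewrite +-comm a (flip b) | +-comm a b = flips-flipˡ b a c

flips-flip² : ∀ a b c → flips (flip a + flip b) c ≡ flips (a + b) c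
flips-flip² a b c = begin
  flips (flip a + flip b) c     ≡⟨ flips-flipˡ a (flip b) c ⟩
  flip (flips (a + flip b) c)   ≡⟨ cong flip (flips-flipʳ a b c) ⟩
  flip (flip (flips (a + b) c)) ≡⟨ flip-involutive _ ⟩
  flips (a + b) c               ∎

-- The last component carries both the block of c and the parity of a + b + c.
class : ℕ → ℕ → ℕ → ℕ × ℕ × ℕ
class a b c = ⌊ a /2⌋ , ⌊ b /2⌋ , flips (a + b) c

-- Within a block, different means flipped. Two flips preserve the parity of `a + b`, so one and the
-- same injection sends `c` and `c′` to the last component.
class-intersecting : ∀ a b c a′ b′ c′ → a ≢ a′ → b ≢ b′ →
                     class a b c ≡ class a′ b′ c′ → c ≡ c′
class-intersecting a b c a′ b′ c′ a≢a′ b≢b′ eq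
  with refl ← ⌊/2⌋-≡⇒flip a a′ (cong proj₁ eq) a≢a′
     | refl ← ⌊/2⌋-≡⇒flip b b′ (cong (proj₁ ∘ proj₂) eq) b≢b′ =
  flips-injective (a′ + b′)
    (trans (sym (flips-flip² a′ b′ c)) (cong (proj₂ ∘ proj₂) eq))

avoid : ∀ a i → ∃[ a′ ] (a′ ≢ a × ⌊ a′ /2⌋ ≡ i)
avoid a i with ⌊ a /2⌋ ≟ i
... | yes eq = flip a , flip-≢ a , trans (⌊flip/2⌋ a) eq
... | no neq = i + i , (λ { refl → neq (sym (n≡⌊n+n/2⌋ i)) }) , sym (n≡⌊n+n/2⌋ i)

-- Both members of block `i` differ from `a`, and they give values of `flips` that are flips of each
-- other, so at most one of them gives `c`.
avoid-both : ∀ a i b c d → ⌊ a /2⌋ ≢ i →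
             ∃[ a′ ] (a′ ≢ a × ⌊ a′ /2⌋ ≡ i × flips (a′ + b) d ≢ c)
avoid-both a i b c d neq with avoid a i
... | a′ , a′≢a , eq with flips (a′ + b) d ≟ c
... | no  ≢c = a′ , a′≢a , eq , ≢c
... | yes ≡c = flip a′ , (λ { refl → neq eq′ }) , eq′ , ≢c
  where
  eq′ : ⌊ flip a′ /2⌋ ≡ i
  eq′ = trans (⌊flip/2⌋ a′) eq
  ≢c : flips (flip a′ + b) d ≢ c
  ≢c e = flip-≢ c (trans (cong flip (sym ≡c)) (trans (sym (flips-flipˡ a′ b d)) e))

Avoidable : ℕ → ℕ → ℕ → ℕ × ℕ × ℕ → Set
Avoidable a b c t =
  ∃[ a′ ] ∃[ b′ ] ∃[ c′ ] (a′ ≢ a × b′ ≢ b × c′ ≢ c × class a′ b′ c′ ≡ t)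

-- Since `flips` is an involution, `a′`, `b′` and the target class determine the third coordinate;
-- only its difference from `c` has to be arranged.
complete : ∀ {a b c i j d} a′ b′ → a′ ≢ a → b′ ≢ b → ⌊ a′ /2⌋ ≡ i → ⌊ b′ /2⌋ ≡ j →
           flips (a′ + b′) d ≢ c → Avoidable a b c (i , j , d)
complete {d = d} a′ b′ a′≢a b′≢b refl refl c′≢c =
  a′ , b′ , flips (a′ + b′) d , a′≢a , b′≢b , c′≢c ,
  cong (λ e → _ , _ , e) (flips-involutive (a′ + b′) d)

class-avoidable : ∀ a b c t → class a b c ≢ t → Avoidable a b c t
class-avoidable a b c (i , j , d) neq with ⌊ a /2⌋ ≟ i | ⌊ b /2⌋ ≟ j
... | no a≁i | _ =
  let b′ , b′≢b , b′∼j = avoid b j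
      a′ , a′≢a , a′∼i , c′≢c = avoid-both a i b′ c d a≁i
  in complete a′ b′ a′≢a b′≢b a′∼i b′∼j c′≢c
... | yes _ | no b≁j =
  let a′ , a′≢a , a′∼i = avoid a i
      b′ , b′≢b , b′∼j , c′≢c = avoid-both b j a′ c d b≁j
  in complete a′ b′ a′≢a b′≢b a′∼i b′∼j
       (c′≢c ∘ trans (cong (λ k → flips k d) (+-comm b′ a′)))
-- No freedom remains in the first two coordinates, but the forced third one equals `c` only if the
-- target is the class of `(a , b , c)` itself. The block of `c` needs no case split.
... | yes refl | yes refl =
  complete (flip a) (flip b) (flip-≢ a) (flip-≢ b) (⌊flip/2⌋ a) (⌊flip/2⌋ b) λ e →
    neq (cong (λ e → _ , _ , e) (begin
      flips (a + b) c                 ≡⟨ cong (flips (a + b)) (sym e) ⟩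
      flips (a + b) (flips (flip a + flip b) d)
        ≡⟨ cong (flips (a + b)) (flips-flip² a b d) ⟩
      flips (a + b) (flips (a + b) d) ≡⟨ flips-involutive (a + b) d ⟩
      d                               ∎))

code : ℕ × ℕ × ℕ → ℕ
code (i , j , d) = pair (i , pair (j , d))

decode : ℕ → ℕ × ℕ × ℕ
decode n = proj₁ (unpair n) , unpair (proj₂ (unpair n))

code-injective : ∀ {t u} → code t ≡ code u → t ≡ u
code-injective eq with pair-injective eq
... | eq′ = cong₂ _,_ (cong proj₁ eq′) (pair-injective (cong proj₂ eq′))

code-decode : ∀ n → code (decode n) ≡ n
code-decode n =
  trans (cong (λ k → pair (proj₁ (unpair n) , k)) (pair-unpair (proj₂ (unpair n))))
        (pair-unpair n)

triple-class : (ℕ → ℕ) → ℕ × ℕ × ℕ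
triple-class x = class (x 0) (x 1) (x 2)

parityColoring : Coloring
parityColoring = record
  { to   = code ∘ triple-class
  ; cong = λ x≗y → cong code
      (cong₂ (λ a → λ { (b , c) → class a b c }) (x≗y 0) (cong₂ _,_ (x≗y 1) (x≗y 2)))
  }

parityColoring-proper : Proper parityColoring
parityColoring-proper x y x⊥y eq =
  x⊥y 2 (class-intersecting (x 0) (x 1) (x 2) (y 0) (y 1) (y 2) (x⊥y 0) (x⊥y 1)
    (code-injective eq))

parityColoring-tight : Tight parityColoring
parityColoring-tight x β neq
  with class-avoidable (x 0) (x 1) (x 2) (decode β)
         (λ eq → neq (trans (cong code eq) (code-decode β)))
... | a , b , c , a≢ , b≢ , c≢ , eq = y , y⊥x , trans (cong code eq) (code-decode β)
  where
  y : ℕ → ℕ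
  y 0 = a
  y 1 = b
  y 2 = c
  -- The color ignores these coordinates, so any value other than `x n` will do.
  y n = suc (x n)
  y⊥x : y ⊥ x
  y⊥x 0 = a≢
  y⊥x 1 = b≢
  y⊥x 2 = c≢
  y⊥x (suc (suc (suc n))) = 1+n≢n

zeros : ℕ → ℕ
zeros _ = 0

two-at-0 : ℕ → ℕ
two-at-0 zero    = 2
two-at-0 (suc _) = 0

two-at-1 : ℕ → ℕ
two-at-1 1 = 2
two-at-1 _ = 0

-- A change from 0 to 2 at a coordinate other than `i` leaves `x i` alone but moves to another
-- block; the two colors compute to distinct numerals.
parityColoring-nontrivial : NonTrivial parityColoring
parityColoring-nontrivial (zero , π , eq)
  with () ← trans (eq zeros) (sym (eq two-at-1))
parityColoring-nontrivial (suc i , π , eq)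
  with () ← trans (eq zeros) (sym (eq two-at-0))

corollary7p8 : Σ[ F ∈ Coloring ] (Proper F × Tight F × NonTrivial F)
corollary7p8 =
  parityColoring , parityColoring-proper , parityColoring-tight , parityColoring-nontrivial
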